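{- For every graph $G=(V,E)$ with at least one edge, $av_1(G)\ge 2$. Equality holds if and only if $N(u)\cup N(v)=V$ for every edge $uv\in E$. In particular, for $n\ge 2$ the star $S_n$ is the unique $n$-vertex tree minimising $av_1$, and it is one of the $n$-vertex graphs with at least one edge minimising $av_1$.
   Context: All graphs are finite and simple. For a graph $G=(V,E)$, a set $S\subseteq V$ is a $1$-nearly independent vertex set if the subgraph induced by $S$ has exactly one edge. $\sigma_1(G)$ is the number of such sets, $S_1(G)$ the sum of their sizes, and $av_1(G)=S_1(G)/\sigma_1(G)$. $N(v)$ is the set of neighbours of $v$. $S_n$ is the star on $n$ vertices. -}

module Defs where

open import Data.Empty using (⊥-elim)
open import Data.Fin using (Fin; zero; suc; toℕ; fromℕ; inject₁; _<_)
open import Data.Fin.Permutation using (Permutation′; _⟨$⟩ʳ_)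
open import Data.Fin.Properties using (_<?_; <-cmp; <-asym)
open import Data.Fin.Subset using (Subset; inside; outside; _∈_; _∪_; ⁅_⁆; ∣_∣)
open import Data.Fin.Subset.Properties using (_∈?_; x∈p∪q⁺; x∈p∪q⁻; x∈⁅x⁆; x∈⁅y⁆⇒x≡y)
open import Data.Integer using (+_)
open import Data.List using (List; []; _∷_; _++_; map; filter; length; allFin; cartesianProduct)
open import Data.List.Membership.Propositional using () renaming (_∈_ to _∈ˡ_)
open import Data.List.Membership.Propositional.Properties
  using (∈-map⁺; ∈-++⁺ˡ; ∈-++⁺ʳ; ∈-filter⁺; ∈-filter⁻; ∈-cartesianProduct⁺; ∈-allFin; ∈-length)
open import Data.List.Relation.Unary.All using () renaming (_∷_ to _∷ᵃ_)
open import Data.List.Relation.Unary.AllPairs using () renaming (_∷_ to _∷ᵖ_)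
open import Data.List.Relation.Unary.Any using (here; there)
open import Data.List.Relation.Unary.Unique.Propositional using (Unique)
open import Data.List.Relation.Unary.Unique.Propositional.Properties using (allFin⁺; cartesianProduct⁺; filter⁺)
open import Data.Nat as ℕ using (ℕ; NonZero; s≤s; z≤n; >-nonZero)
open import Data.Nat.ListAction using (sum)
open import Data.Product using (Σ-syntax; ∃₂; _×_; _,_; proj₂)
open import Data.Rational as ℚ using (ℚ; _/_)
open import Data.Sum using (_⊎_; inj₁; inj₂; swap)
open import Data.Vec using ([]; _∷_; tabulate)
open import Function using (_⇔_)
open import Function.Definitions using (Injective)
open import Level using (0ℓ)
open import Relation.Binary using (Rel; Symmetric; Irreflexive; Decidable; tri<; tri≈; tri>)
open import Relation.Binary.Construct.Closure.ReflexiveTransitive using (Star; ε; _◅_)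
open import Relation.Binary.PropositionalEquality using (_≡_; _≢_; refl; sym)
open import Relation.Nullary using (¬_; Dec; does)
open import Relation.Nullary.Decidable using (_×-dec_; _⊎-dec_; ¬?)
open import Relation.Unary using (Pred)

record Graph (n : ℕ) : Set₁ where
  infix 4 _~_ _~?_
  field
    _~_      : Rel (Fin n) 0ℓ
    ~-sym    : Symmetric _~_
    ~-irrefl : Irreflexive _≡_ _~_
    _~?_     : Decidable _~_

  N : Fin n → Subset n
  N v = tabulate λ w → does (v ~? w)

open Graph using (N)

HasEdge : ∀ {n} → Graph n → Set
HasEdge G = ∃₂ λ u v → u ~ v
  where open Graph G

allSubsets : ∀ n → List (Subset n)
allSubsets ℕ.zero    = [] ∷ []
allSubsets (ℕ.suc n) = map (outside ∷_) (allSubsets n) ++ map (inside ∷_) (allSubsets n)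

module _ {n} (G : Graph n) where
  open Graph G

  -- An unordered edge {i , j} is represented once, by the pair with i < j.
  IsInducedEdge : Subset n → Fin n × Fin n → Set
  IsInducedEdge S (i , j) = i < j × i ~ j × i ∈ S × j ∈ S

  isInducedEdge? : ∀ S e → Dec (IsInducedEdge S e)
  isInducedEdge? S (i , j) = i <? j ×-dec i ~? j ×-dec i ∈? S ×-dec j ∈? S

  inducedEdges : Subset n → List (Fin n × Fin n)
  inducedEdges S = filter (isInducedEdge? S) (cartesianProduct (allFin n) (allFin n))

  OneNearlyIndependent : Subset n → Set
  OneNearlyIndependent S = length (inducedEdges S) ≡ 1

  oneNearlyIndependent? : ∀ S → Dec (OneNearlyIndependent S)
  oneNearlyIndependent? S = length (inducedEdges S) ℕ.≟ 1

  oneNearlyIndependentSets : List (Subset n)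
  oneNearlyIndependentSets = filter oneNearlyIndependent? (allSubsets n)

  σ₁ : ℕ
  σ₁ = length oneNearlyIndependentSets

  S₁ : ℕ
  S₁ = sum (map ∣_∣ oneNearlyIndependentSets)

∈-allSubsets : ∀ {n} (S : Subset n) → S ∈ˡ allSubsets n
∈-allSubsets []            = here refl
∈-allSubsets (outside ∷ S) = ∈-++⁺ˡ (∈-map⁺ (outside ∷_) (∈-allSubsets S))
∈-allSubsets (inside  ∷ S) = ∈-++⁺ʳ _ (∈-map⁺ (inside ∷_) (∈-allSubsets S))

length≡1 : ∀ {a} {A : Set a} {x : A} {xs} → Unique xs → x ∈ˡ xs →
           (∀ {y} → y ∈ˡ xs → y ≡ x) → length xs ≡ 1
length≡1 {xs = _ ∷ []}    _                  _ _   = refl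
length≡1 {xs = y ∷ z ∷ _} ((y≢z ∷ᵃ _) ∷ᵖ _) _ all≡ with refl ← all≡ (here refl) =
  ⊥-elim (y≢z (sym (all≡ (there (here refl)))))

module _ {n} (G : Graph n) where
  open Graph G

  edge-oneNearlyIndependent : ∀ {u v} → u < v → u ~ v →
                              OneNearlyIndependent G (⁅ u ⁆ ∪ ⁅ v ⁆)
  edge-oneNearlyIndependent {u} {v} u<v u~v = length≡1
    (filter⁺ (isInducedEdge? G S) (cartesianProduct⁺ (allFin⁺ n) (allFin⁺ n)))
    (∈-filter⁺ (isInducedEdge? G S) (∈-cartesianProduct⁺ (∈-allFin u) (∈-allFin v))
      (u<v , u~v , x∈p∪q⁺ (inj₁ (x∈⁅x⁆ u)) , x∈p∪q⁺ (inj₂ (x∈⁅x⁆ v))))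
    λ e∈ → only (proj₂ (∈-filter⁻ (isInducedEdge? G S)
                         {xs = cartesianProduct (allFin n) (allFin n)} e∈))
    where
    S : Subset n
    S = ⁅ u ⁆ ∪ ⁅ v ⁆

    ∈S : ∀ {x} → x ∈ S → x ≡ u ⊎ x ≡ v
    ∈S x∈S with x∈p∪q⁻ ⁅ u ⁆ ⁅ v ⁆ x∈S
    ... | inj₁ x∈u = inj₁ (x∈⁅y⁆⇒x≡y u x∈u)
    ... | inj₂ x∈v = inj₂ (x∈⁅y⁆⇒x≡y v x∈v)

    only : ∀ {e} → IsInducedEdge G S e → e ≡ (u , v)
    only (i<j , i~j , i∈S , j∈S) with ∈S i∈S | ∈S j∈S
    ... | inj₁ refl | inj₂ refl = refl
    ... | inj₁ refl | inj₁ refl = ⊥-elim (~-irrefl refl i~j)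
    ... | inj₂ refl | inj₂ refl = ⊥-elim (~-irrefl refl i~j)
    ... | inj₂ refl | inj₁ refl = ⊥-elim (<-asym u<v i<j)

  σ₁-nonZero : HasEdge G → NonZero (σ₁ G)
  σ₁-nonZero (u , v , u~v) with <-cmp u v
  ... | tri≈ _ u≡v _ = ⊥-elim (~-irrefl u≡v u~v)
  ... | tri< u<v _ _ = >-nonZero (∈-length (∈-filter⁺ (oneNearlyIndependent? G)
                         (∈-allSubsets _) (edge-oneNearlyIndependent u<v u~v)))
  ... | tri> _ _ v<u = >-nonZero (∈-length (∈-filter⁺ (oneNearlyIndependent? G)
                         (∈-allSubsets _) (edge-oneNearlyIndependent v<u (~-sym u~v))))

  av₁ : HasEdge G → ℚ
  av₁ e = _/_ (+ S₁ G) (σ₁ G) {{σ₁-nonZero e}}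

module _ {n} (G : Graph n) where
  open Graph G

  Connected : Set
  Connected = ∀ u v → Star _~_ u v

  -- A cycle of length k + 3, listed by its distinct vertices in cyclic order.
  record Cycle (k : ℕ) : Set where
    field
      vertex    : Fin (3 ℕ.+ k) → Fin n
      injective : Injective _≡_ _≡_ vertex
      step      : ∀ i → vertex (inject₁ i) ~ vertex (suc i)
      close     : vertex (fromℕ (2 ℕ.+ k)) ~ vertex zero

  Acyclic : Set
  Acyclic = ∀ k → ¬ Cycle k

  record IsTree : Set where
    field
      nonEmpty  : NonZero n
      connected : Connected
      acyclic   : Acyclic

tree-hasEdge : ∀ {n} → 2 ℕ.≤ n → {G : Graph n} → IsTree G → HasEdge G
tree-hasEdge (s≤s (s≤s z≤n)) t with IsTree.connected t zero (suc zero)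
... | 0~v ◅ _ = _ , _ , 0~v

-- The vertex with index 0 is the centre.
star : ∀ n → Graph n
star n = record
  { _~_      = λ u v → (toℕ u ≡ 0 × toℕ v ≢ 0) ⊎ (toℕ v ≡ 0 × toℕ u ≢ 0)
  ; ~-sym    = swap
  ; ~-irrefl = λ { refl (inj₁ (p , q)) → q p ; refl (inj₂ (p , q)) → q p }
  ; _~?_     = λ u v → (toℕ u ℕ.≟ 0 ×-dec ¬? (toℕ v ℕ.≟ 0))
                       ⊎-dec (toℕ v ℕ.≟ 0 ×-dec ¬? (toℕ u ℕ.≟ 0))
  }

infix 4 _≅_
_≅_ : ∀ {n} → Graph n → Graph n → Set
_≅_ {n} G H = Σ[ π ∈ Permutation′ n ] (∀ u v → (u G.~ v) ⇔ ((π ⟨$⟩ʳ u) H.~ (π ⟨$⟩ʳ v)))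
  where
  module G = Graph G
  module H = Graph H

-- G minimises av₁ within the class P of n-vertex graphs, all of which have an edge.
IsMinimiser : ∀ {n ℓ} (P : Pred (Graph n) ℓ) → (∀ {G} → P G → HasEdge G) →
              Pred (Graph n) _
IsMinimiser P hasEdge G =
  Σ[ p ∈ P G ] (∀ H (q : P H) → av₁ G (hasEdge p) ℚ.≤ av₁ H (hasEdge q))

{-# OPTIONS --safe #-}

-- A 1-nearly independent set contains the two ends of its edge, so it has at
-- least two elements and av₁ ≥ 2, with equality iff every such set is the
-- pair of ends of an edge.  A vertex outside N(u) ∪ N(v) could be added to {u , v};
-- conversely, when N(u) ∪ N(v) = V any third vertex would bring a second edge.
-- A tree all of whose edges uv satisfy N(u) ∪ N(v) = V has a universal vertex: if
-- w ~ u and x ~ v for an edge uv, then x has to be adjacent to u or w, which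
-- closes a triangle or a 4-cycle.
module Submission where

open import Defs
open import Data.Empty using (⊥; ⊥-elim)
open import Data.Fin using (Fin; zero; suc; toℕ; fromℕ; _<_)
open import Data.Fin.Patterns using (0F; 1F; 2F)
open import Data.Fin.Permutation using (Permutation′; _⟨$⟩ʳ_; transpose)
open import Data.Fin.Properties using (_≟_; <⇒≢; <-cmp; <-asym; toℕ-injective; any?)
open import Data.Fin.Subset using (Subset; inside; outside; _∈_; _⊆_; _∪_; _-_; ⁅_⁆; ⊤; ∣_∣)
open import Data.Fin.Subset.Properties
  using (x∈p∪q⁺; x∈p∪q⁻; x∈⁅x⁆; x∈⁅y⁆⇒x≡y; ∣⁅x⁆∣≡1;
         p⊆q⇒∣p∣≤∣q∣; x∈p∧x≢y⇒x∈p-y; x∈p⇒∣p-x∣<∣p∣; ∈⊤; ⊆⊤; ⊆-antisym)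
open import Data.Integer as ℤ using (+_; +≤+)
import Data.Integer.Properties as ℤ
open import Data.List using (List; []; _∷_; map; length; allFin; cartesianProduct)
open import Data.List.Membership.Propositional.Properties
  using (∈-filter⁺; ∈-filter⁻; ∈-cartesianProduct⁺; ∈-allFin)
open import Data.List.Relation.Unary.All as All using (All; []; _∷_)
open import Data.List.Relation.Unary.All.Properties using (all-filter)
open import Data.List.Relation.Unary.Any using (here)
open import Data.List.Membership.Propositional using () renaming (_∈_ to _∈ˡ_)
open import Data.List.Relation.Unary.Unique.Propositional.Properties using (allFin⁺; cartesianProduct⁺; filter⁺)
open import Data.Nat as ℕ using (ℕ; NonZero; s≤s; z≤n)
open import Data.Nat.ListAction using (sum)
import Data.Nat.Properties as ℕ
open import Data.Product using (_×_; _,_; proj₁; proj₂; ∃; ∃-syntax)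
open import Data.Rational as ℚ using (_/_; _≤_)
import Data.Rational.Properties as ℚ
open import Data.Rational.Unnormalised as ℚᵘ using (mkℚᵘ; *≤*; *≡*)
import Data.Rational.Unnormalised.Properties as ℚᵘ
open import Data.Sum as Sum using (_⊎_; inj₁; inj₂; swap)
open import Data.Vec as Vec using ([]; _∷_)
open import Data.Vec.Properties using (lookup∘tabulate; []=⇒lookup; lookup⇒[]=)
open import Data.Vec.Relation.Unary.All using ([]; _∷_)
open import Data.Vec.Relation.Unary.AllPairs using ([]; _∷_)
open import Data.Vec.Relation.Unary.Unique.Propositional.Properties using (lookup-injective)
open import Function using (_⇔_; id; _∘_; mk⇔; Equivalence; Injection)
open import Function.Properties.Inverse using (↔⇒↣)
open import Relation.Binary using (tri<; tri≈; tri>)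
open import Relation.Binary.Construct.Closure.ReflexiveTransitive using (ε; _◅_)
open import Relation.Binary.PropositionalEquality
open import Relation.Nullary using (¬_; Dec; yes; no; does)
open import Relation.Nullary.Decidable using (_×-dec_; ¬?; dec-true)

private
  variable
    n : ℕ

-- Comparing a quotient of naturals with a natural number.

k*d≤m⇒k≤m/d : ∀ k m d .{{_ : NonZero d}} → d ℕ.* k ℕ.≤ m → + k / 1 ≤ + m / d
-- `_/_` cancels common factors, so cross-multiplication is done in the unnormalised rationals.
-- Matching `d` exposes the `d-1` that `mkℚᵘ` stores as denominator.
k*d≤m⇒k≤m/d k m d@(ℕ.suc d-1) dk≤m = ℚ.toℚᵘ-cancel-≤
  (ℚᵘ.≤-respˡ-≃ (ℚᵘ.≃-sym (ℚ.toℚᵘ-fromℚᵘ (mkℚᵘ (+ k) 0)))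
  (ℚᵘ.≤-respʳ-≃ (ℚᵘ.≃-sym (ℚ.toℚᵘ-fromℚᵘ (mkℚᵘ (+ m) d-1)))
  (*≤* (subst₂ ℤ._≤_
    (trans (cong +_ (ℕ.*-comm d k)) (ℤ.pos-* k d)) (sym (ℤ.*-identityʳ (+ m))) (+≤+ dk≤m)))))

m/d≡k⇔m≡d*k : ∀ k m d .{{_ : NonZero d}} → (+ m / d ≡ + k / 1) ⇔ (m ≡ d ℕ.* k)
m/d≡k⇔m≡d*k k m d@(ℕ.suc d-1) = mk⇔
  (λ eq → ℤ.+-injective (trans (sym (ℤ.*-identityʳ (+ m)))
    (trans (ℚᵘ.drop-*≡* (ℚ.fromℚᵘ-injective {mkℚᵘ (+ m) d-1} {mkℚᵘ (+ k) 0} eq)) kd)))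
  (λ eq → ℚ.fromℚᵘ-cong {mkℚᵘ (+ m) d-1} {mkℚᵘ (+ k) 0}
    (*≡* (trans (ℤ.*-identityʳ (+ m)) (trans (cong +_ eq) (sym kd)))))
  where
  kd : + k ℤ.* + d ≡ + (d ℕ.* k)
  kd = trans (sym (ℤ.pos-* k d)) (cong +_ (ℕ.*-comm k d))

-- Sums whose terms are bounded below.

module _ {a} {A : Set a} (f : A → ℕ) {k : ℕ} where

  sum-lower : ∀ {xs} → All (λ x → k ℕ.≤ f x) xs → length xs ℕ.* k ℕ.≤ sum (map f xs)
  sum-lower []         = z≤n
  sum-lower (k≤ ∷ k≤s) = ℕ.+-mono-≤ k≤ (sum-lower k≤s)

  -- A head above `k`, added to a tail that meets its own lower bound, would push the total past
  -- `length xs * k`. So the head is `k` and cancels.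
  sum-lower-tight : ∀ {xs} → All (λ x → k ℕ.≤ f x) xs →
                    sum (map f xs) ≡ length xs ℕ.* k → All (λ x → f x ≡ k) xs
  sum-lower-tight                 []         _  = []
  sum-lower-tight {xs = x ∷ xs} (k≤ ∷ k≤s) eq =
    fx≡k ∷ sum-lower-tight k≤s (ℕ.+-cancelˡ-≡ k _ _ (subst (λ y → y ℕ.+ sum (map f xs) ≡ _) fx≡k eq))
    where
    fx≡k : f x ≡ k
    fx≡k = sym (ℕ.≤∧≮⇒≡ k≤ λ k<fx →
      ℕ.<-irrefl (sym eq) (ℕ.+-mono-<-≤ k<fx (sum-lower k≤s)))

  sum-constant : ∀ {xs} → All (λ x → f x ≡ k) xs → sum (map f xs) ≡ length xs ℕ.* k
  sum-constant []         = refl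
  sum-constant (eq ∷ eqs) = cong₂ ℕ._+_ eq (sum-constant eqs)

length≡1⁻ : ∀ {a} {A : Set a} {xs : List A} → length xs ≡ 1 →
            ∃[ x ] x ∈ˡ xs × (∀ {y} → y ∈ˡ xs → y ≡ x)
length≡1⁻ {xs = x ∷ []} _ = x , here refl , λ { (here eq) → eq }

-- Sizes of small subsets.

∣p∪q∣≤∣p∣+∣q∣ : ∀ (p q : Subset n) → ∣ p ∪ q ∣ ℕ.≤ ∣ p ∣ ℕ.+ ∣ q ∣
∣p∪q∣≤∣p∣+∣q∣ []            []            = z≤n
∣p∪q∣≤∣p∣+∣q∣ (outside ∷ p) (outside ∷ q) = ∣p∪q∣≤∣p∣+∣q∣ p q
∣p∪q∣≤∣p∣+∣q∣ (outside ∷ p) (inside  ∷ q) =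
  ℕ.≤-trans (s≤s (∣p∪q∣≤∣p∣+∣q∣ p q)) (ℕ.≤-reflexive (sym (ℕ.+-suc ∣ p ∣ ∣ q ∣)))
∣p∪q∣≤∣p∣+∣q∣ (inside  ∷ p) (outside ∷ q) = s≤s (∣p∪q∣≤∣p∣+∣q∣ p q)
∣p∪q∣≤∣p∣+∣q∣ (inside  ∷ p) (inside  ∷ q) =
  s≤s (ℕ.≤-trans (∣p∪q∣≤∣p∣+∣q∣ p q) (ℕ.+-monoʳ-≤ ∣ p ∣ (ℕ.n≤1+n ∣ q ∣)))

∣⁅u⁆∪⁅v⁆∣≤2 : ∀ (u v : Fin n) → ∣ ⁅ u ⁆ ∪ ⁅ v ⁆ ∣ ℕ.≤ 2
∣⁅u⁆∪⁅v⁆∣≤2 u v = ℕ.≤-trans (∣p∪q∣≤∣p∣+∣q∣ ⁅ u ⁆ ⁅ v ⁆)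
  (ℕ.≤-reflexive (cong₂ ℕ._+_ (∣⁅x⁆∣≡1 u) (∣⁅x⁆∣≡1 v)))

x∈p⇒1+m≤∣p∣ : ∀ {x : Fin n} {p m} → x ∈ p → m ℕ.≤ ∣ p - x ∣ → ℕ.suc m ℕ.≤ ∣ p ∣
x∈p⇒1+m≤∣p∣ x∈p m≤ = ℕ.≤-<-trans m≤ (x∈p⇒∣p-x∣<∣p∣ x∈p)

2≤∣p∣ : ∀ {u v : Fin n} {p} → u ≢ v → u ∈ p → v ∈ p → 2 ℕ.≤ ∣ p ∣
2≤∣p∣ u≢v u∈p v∈p =
  x∈p⇒1+m≤∣p∣ u∈p (x∈p⇒1+m≤∣p∣ (x∈p∧x≢y⇒x∈p-y v∈p (≢-sym u≢v)) z≤n)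

3≤∣p∣ : ∀ {u v w : Fin n} {p} → u ≢ v → u ≢ w → v ≢ w → u ∈ p → v ∈ p → w ∈ p → 3 ℕ.≤ ∣ p ∣
3≤∣p∣ u≢v u≢w v≢w u∈p v∈p w∈p =
  x∈p⇒1+m≤∣p∣ u∈p (2≤∣p∣ v≢w (x∈p∧x≢y⇒x∈p-y v∈p (≢-sym u≢v)) (x∈p∧x≢y⇒x∈p-y w∈p (≢-sym u≢w)))

-- Dominating edges and the sizes of 1-nearly independent sets.

module _ (G : Graph n) where
  open Graph G

  adjacent-≢ : ∀ {u v} → u ~ v → u ≢ v
  adjacent-≢ u~v u≡v = ~-irrefl u≡v u~v

  -- The pair is a total dominating set: neighbourhoods are open, so `u` has to be covered by `v`
  -- and conversely.
  Dominating : Fin n → Fin n → Set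
  Dominating u v = ∀ w → u ~ w ⊎ v ~ w

  ∈N⇔~ : ∀ {v w} → w ∈ N v ⇔ v ~ w
  ∈N⇔~ {v} {w} = mk⇔ to from
    where
    to : w ∈ N v → v ~ w
    to w∈N with v ~? w | trans (sym (lookup∘tabulate (λ x → does (v ~? x)) w)) ([]=⇒lookup w∈N)
    ... | yes v~w | _ = v~w

    from : v ~ w → w ∈ N v
    from v~w = lookup⇒[]= w (N v)
      (trans (lookup∘tabulate (λ x → does (v ~? x)) w) (dec-true (v ~? w) v~w))

  N∪N≡⊤⇔Dominating : ∀ {u v} → N u ∪ N v ≡ ⊤ ⇔ Dominating u v
  N∪N≡⊤⇔Dominating {u} {v} = mk⇔
    (λ eq w → Sum.map (Equivalence.to ∈N⇔~) (Equivalence.to ∈N⇔~)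
                (x∈p∪q⁻ (N u) (N v) (subst (w ∈_) (sym eq) ∈⊤)))
    (λ dom → ⊆-antisym ⊆⊤ λ {w} _ →
       x∈p∪q⁺ (Sum.map (Equivalence.from ∈N⇔~) (Equivalence.from ∈N⇔~) (dom w)))

  oneNearlyIndependent⁻ : ∀ {S} → OneNearlyIndependent G S →
    ∃[ e ] IsInducedEdge G S e × (∀ {e′} → IsInducedEdge G S e′ → e′ ≡ e)
  oneNearlyIndependent⁻ {S} one with length≡1⁻ one
  ... | e , e∈ , only = e
      , proj₂ (∈-filter⁻ (isInducedEdge? G S) {xs = cartesianProduct (allFin n) (allFin n)} e∈)
      , λ {e′} ind → only (∈-filter⁺ (isInducedEdge? G S)
          (∈-cartesianProduct⁺ (∈-allFin (proj₁ e′)) (∈-allFin (proj₂ e′))) ind)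

  oneNearlyIndependent⁺ : ∀ {S e} → IsInducedEdge G S e →
    (∀ {e′} → IsInducedEdge G S e′ → e′ ≡ e) → OneNearlyIndependent G S
  oneNearlyIndependent⁺ {S} {i , j} ind only = length≡1
    (filter⁺ (isInducedEdge? G S) (cartesianProduct⁺ (allFin⁺ n) (allFin⁺ n)))
    (∈-filter⁺ (isInducedEdge? G S) (∈-cartesianProduct⁺ (∈-allFin i) (∈-allFin j)) ind)
    λ e∈ → only (proj₂ (∈-filter⁻ (isInducedEdge? G S)
                         {xs = cartesianProduct (allFin n) (allFin n)} e∈))

  oneNearlyIndependent-size : ∀ {S} → OneNearlyIndependent G S → 2 ℕ.≤ ∣ S ∣
  oneNearlyIndependent-size one with oneNearlyIndependent⁻ one
  ... | _ , (u<v , _ , u∈S , v∈S) , _ = 2≤∣p∣ (<⇒≢ u<v) u∈S v∈S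

  -- Each `x` in `S` is adjacent to `u` or to `v`, both in `S`. That edge is induced, hence it is
  -- `uv` itself, and `x` is one of its ends.
  dominating-size : (∀ u v → u ~ v → Dominating u v) →
                    ∀ {S} → OneNearlyIndependent G S → ∣ S ∣ ≡ 2
  dominating-size dom {S} one with oneNearlyIndependent⁻ one
  ... | (u , v) , (_ , u~v , u∈S , v∈S) , only =
    ℕ.≤-antisym (ℕ.≤-trans (p⊆q⇒∣p∣≤∣q∣ S⊆uv) (∣⁅u⁆∪⁅v⁆∣≤2 u v)) (oneNearlyIndependent-size one)
    where
    u-or-v : ∀ {x} → x ≡ u ⊎ x ≡ v → x ∈ ⁅ u ⁆ ∪ ⁅ v ⁆
    u-or-v (inj₁ refl) = x∈p∪q⁺ (inj₁ (x∈⁅x⁆ u))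
    u-or-v (inj₂ refl) = x∈p∪q⁺ (inj₂ (x∈⁅x⁆ v))

    end : ∀ {x y} → x ∈ S → y ∈ S → y ~ x → x ≡ u ⊎ x ≡ v
    -- Edges are listed with the smaller end first, so the order of `x` and `y` decides which end
    -- `x` is.
    end {x} {y} x∈S y∈S y~x with <-cmp x y
    ... | tri< x<y _ _ = inj₁ (cong proj₁ (only (x<y , ~-sym y~x , x∈S , y∈S)))
    ... | tri≈ _ x≡y _ = ⊥-elim (adjacent-≢ y~x (sym x≡y))
    ... | tri> _ _ y<x = inj₂ (cong proj₂ (only (y<x , y~x , y∈S , x∈S)))

    S⊆uv : S ⊆ ⁅ u ⁆ ∪ ⁅ v ⁆
    S⊆uv {x} x∈S = u-or-v (Sum.[ end x∈S u∈S , end x∈S v∈S ] (dom u v u~v x))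

  -- Adding the uncovered `w` to the two ends creates no edge.
  nonDominating-set : ∀ {u v w} → u < v → u ~ v → ¬ u ~ w → ¬ v ~ w →
                      ∃[ S ] OneNearlyIndependent G S × 3 ℕ.≤ ∣ S ∣
  nonDominating-set {u} {v} {w} u<v u~v u≁w v≁w =
    S , oneNearlyIndependent⁺ (u<v , u~v , u∈S , v∈S) only
      -- `w` differs from both ends because each end is adjacent to the other.
      , 3≤∣p∣ (<⇒≢ u<v) (λ { refl → v≁w (~-sym u~v) }) (λ { refl → u≁w u~v }) u∈S v∈S
              (x∈p∪q⁺ (inj₂ (x∈⁅x⁆ w)))
    where
    S : Subset n
    S = (⁅ u ⁆ ∪ ⁅ v ⁆) ∪ ⁅ w ⁆

    u∈S : u ∈ S
    u∈S = x∈p∪q⁺ (inj₁ (x∈p∪q⁺ (inj₁ (x∈⁅x⁆ u))))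

    v∈S : v ∈ S
    v∈S = x∈p∪q⁺ (inj₁ (x∈p∪q⁺ (inj₂ (x∈⁅x⁆ v))))

    -- Membership in `S` as an indexed type: matching on two members unifies them with `u`, `v`, `w`
    -- and leaves nine cases, of which only `(u , v)` survives.
    data Element : Fin n → Set where
      is-u : Element u
      is-v : Element v
      is-w : Element w

    element : ∀ {x} → x ∈ S → Element x
    element x∈S with x∈p∪q⁻ (⁅ u ⁆ ∪ ⁅ v ⁆) ⁅ w ⁆ x∈S
    ... | inj₂ x∈w rewrite x∈⁅y⁆⇒x≡y w x∈w = is-w
    ... | inj₁ x∈uv with x∈p∪q⁻ ⁅ u ⁆ ⁅ v ⁆ x∈uv
    ...   | inj₁ x∈u rewrite x∈⁅y⁆⇒x≡y u x∈u = is-u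
    ...   | inj₂ x∈v rewrite x∈⁅y⁆⇒x≡y v x∈v = is-v

    only-element : ∀ {i j} → Element i → Element j → i < j → i ~ j → (i , j) ≡ (u , v)
    only-element is-u is-v _   _   = refl
    only-element is-v is-u v<u _   = ⊥-elim (<-asym u<v v<u)
    only-element is-u is-u _   i~j = ⊥-elim (~-irrefl refl i~j)
    only-element is-v is-v _   i~j = ⊥-elim (~-irrefl refl i~j)
    only-element is-w is-w _   i~j = ⊥-elim (~-irrefl refl i~j)
    only-element is-u is-w _   u~w = ⊥-elim (u≁w u~w)
    only-element is-v is-w _   v~w = ⊥-elim (v≁w v~w)
    only-element is-w is-u _   w~u = ⊥-elim (u≁w (~-sym w~u))
    only-element is-w is-v _   w~v = ⊥-elim (v≁w (~-sym w~v))

    only : ∀ {e} → IsInducedEdge G S e → e ≡ (u , v)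
    only (i<j , i~j , i∈S , j∈S) = only-element (element i∈S) (element j∈S) i<j i~j

  size⇒dominating : (∀ {S} → OneNearlyIndependent G S → ∣ S ∣ ≡ 2) →
                    ∀ u v → u ~ v → Dominating u v
  size⇒dominating size≡2 = unordered
    where
    ordered : ∀ {u v} → u < v → u ~ v → Dominating u v
    ordered {u} {v} u<v u~v w with u ~? w | v ~? w
    ... | yes u~w | _       = inj₁ u~w
    ... | no _    | yes v~w = inj₂ v~w
    ... | no u≁w  | no v≁w with nonDominating-set u<v u~v u≁w v≁w
    ...   | _ , one , 3≤∣S∣ = ⊥-elim (ℕ.<-irrefl (sym (size≡2 one)) 3≤∣S∣)

    -- `Dominating` is symmetric in its two vertices, so the order imposed on listed edges costs
    -- nothing.
    unordered : ∀ u v → u ~ v → Dominating u v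
    unordered u v u~v with <-cmp u v
    ... | tri< u<v _ _ = ordered u<v u~v
    ... | tri≈ _ u≡v _ = ⊥-elim (~-irrefl u≡v u~v)
    ... | tri> _ _ v<u = swap ∘ ordered v<u (~-sym u~v)

  -- The average and its equality case.

  all-sets : All (OneNearlyIndependent G) (oneNearlyIndependentSets G)
  all-sets = all-filter (oneNearlyIndependent? G) (allSubsets n)

  2≤av₁ : ∀ e → + 2 / 1 ≤ av₁ G e
  2≤av₁ e = k*d≤m⇒k≤m/d 2 (S₁ G) (σ₁ G) {{σ₁-nonZero G e}}
    (sum-lower ∣_∣ (All.map oneNearlyIndependent-size all-sets))

  av₁≡2⇔dominating : ∀ e → av₁ G e ≡ + 2 / 1 ⇔ (∀ u v → u ~ v → Dominating u v)
  av₁≡2⇔dominating e = mk⇔ (λ eq → size⇒dominating λ one → All.lookup (sizes eq)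
                                 -- The enumeration misses no subset, so what holds for its entries
                                 -- holds for every 1-nearly independent set.
                                 (∈-filter⁺ (oneNearlyIndependent? G) (∈-allSubsets _) one))
    (λ dom → Equivalence.from ratio (sum-constant ∣_∣ (All.map (dominating-size dom) all-sets)))
    where
    ratio : av₁ G e ≡ + 2 / 1 ⇔ S₁ G ≡ σ₁ G ℕ.* 2
    ratio = m/d≡k⇔m≡d*k 2 (S₁ G) (σ₁ G) {{σ₁-nonZero G e}}

    sizes : av₁ G e ≡ + 2 / 1 → All (λ S → ∣ S ∣ ≡ 2) (oneNearlyIndependentSets G)
    sizes eq = sum-lower-tight ∣_∣ (All.map oneNearlyIndependent-size all-sets) (Equivalence.to ratio eq)

  -- Short cycles and universal vertices.

  triangle : ∀ {a b c} → a ~ b → b ~ c → c ~ a → Cycle G 0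
  triangle {a} {b} {c} a~b b~c c~a = record
    { vertex    = Vec.lookup (a ∷ b ∷ c ∷ [])
    ; injective = lookup-injective
        ((adjacent-≢ a~b ∷ ≢-sym (adjacent-≢ c~a) ∷ []) ∷ (adjacent-≢ b~c ∷ []) ∷ [] ∷ []) _ _
    ; step      = λ { 0F → a~b ; 1F → b~c }
    ; close     = c~a
    }

  square : ∀ {a b c d} → a ~ b → b ~ c → c ~ d → d ~ a → a ≢ c → b ≢ d → Cycle G 1
  square {a} {b} {c} {d} a~b b~c c~d d~a a≢c b≢d = record
    { vertex    = Vec.lookup (a ∷ b ∷ c ∷ d ∷ [])
    ; injective = lookup-injective
        ((adjacent-≢ a~b ∷ a≢c ∷ ≢-sym (adjacent-≢ d~a) ∷ [])
          ∷ (adjacent-≢ b~c ∷ b≢d ∷ []) ∷ (adjacent-≢ c~d ∷ []) ∷ [] ∷ []) _ _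
    ; step      = λ { 0F → a~b ; 1F → b~c ; 2F → c~d }
    ; close     = d~a
    }

  Universal : Fin n → Set
  Universal c = ∀ w → w ≢ c → c ~ w

  -- If `v` is the only neighbour of `u`, domination by `uv` sends every other vertex to `v`. If `u`
  -- has a further neighbour `w`, then `u` is universal: a vertex `x` other than `u` and not
  -- adjacent to it would be adjacent to both `v` and `w`.
  dominating∧acyclic⇒universal : HasEdge G → Acyclic G → (∀ u v → u ~ v → Dominating u v) → ∃ Universal
  dominating∧acyclic⇒universal (u , v , u~v) acyclic dom
    with any? (λ w → u ~? w ×-dec ¬? (w ≟ v))
  ... | no no-w = v , λ w w≢v →
        Sum.[ (λ u~w → ⊥-elim (no-w (w , u~w , w≢v))) , id ] (dom u v u~v w)
  ... | yes (w , u~w , w≢v) = u , universal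
    where
    universal : Universal u
    universal x x≢u with dom u v u~v x
    ... | inj₁ u~x = u~x
    ... | inj₂ v~x with dom u w u~w x
    ...   | inj₁ u~x = u~x
    -- The 4-cycle is `u`, `w`, `x`, `v`; the last two arguments separate its opposite vertices.
    ...   | inj₂ w~x = ⊥-elim (acyclic 1 (square u~w w~x (~-sym v~x) (~-sym u~v) (≢-sym x≢u) w≢v))

-- The star, and its characterisation by a universal vertex.

module _ {n : ℕ} where
  private
    module ⋆ = Graph (star (ℕ.suc n))

  -- One end of every edge is the centre, which covers all the leaves; the other end covers the
  -- centre.
  star-dominating : ∀ u v → u ⋆.~ v → Dominating (star (ℕ.suc n)) u v
  star-dominating u v u~v w with u~v | toℕ w ℕ.≟ 0
  ... | inj₁ (u≡0 , v≢0) | no  w≢0 = inj₁ (inj₁ (u≡0 , w≢0))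
  ... | inj₁ (u≡0 , v≢0) | yes w≡0 = inj₂ (inj₂ (w≡0 , v≢0))
  ... | inj₂ (v≡0 , u≢0) | no  w≢0 = inj₂ (inj₁ (v≡0 , w≢0))
  ... | inj₂ (v≡0 , u≢0) | yes w≡0 = inj₁ (inj₂ (w≡0 , u≢0))

  star-connected : Connected (star (ℕ.suc n))
  star-connected zero    zero    = ε
  star-connected zero    (suc v) = inj₁ (refl , λ ()) ◅ ε
  star-connected (suc u) zero    = inj₂ (refl , λ ()) ◅ ε
  star-connected (suc u) (suc v) = inj₂ (refl , λ ()) ◅ inj₁ (refl , λ ()) ◅ ε

  -- Every edge meets the centre, which occurs at most once on a cycle. At position 0 it misses the
  -- edge from 1 to 2; at position 1 it misses the closing edge, from position `2 + k` to 0.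
  star-acyclic : Acyclic (star (ℕ.suc n))
  star-acyclic k cycle = contradict (step 0F) (step 1F) close
    where
    open Cycle cycle

    centre-unique : ∀ {i j} → toℕ (vertex i) ≡ 0 → toℕ (vertex j) ≡ 0 → i ≡ j
    centre-unique i≡0 j≡0 = injective (toℕ-injective (trans i≡0 (sym j≡0)))

    contradict : vertex 0F ⋆.~ vertex 1F → vertex 1F ⋆.~ vertex 2F →
                 vertex (fromℕ (2 ℕ.+ k)) ⋆.~ vertex 0F → ⊥
    contradict (inj₁ (_ , 1≢0))   (inj₁ (1≡0 , _)) _                = 1≢0 1≡0
    contradict (inj₁ (0≡0 , _))   (inj₂ (2≡0 , _)) _                with () ← centre-unique 0≡0 2≡0
    contradict (inj₂ (_ , 0≢0))   _                (inj₂ (0≡0 , _)) = 0≢0 0≡0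
    contradict (inj₂ (1≡0 , _))   _                (inj₁ (l≡0 , _)) with () ← centre-unique 1≡0 l≡0

  star-isTree : IsTree (star (ℕ.suc n))
  star-isTree = record { nonEmpty = _ ; connected = star-connected ; acyclic = star-acyclic }

  -- Exchanging `c` with vertex 0 is enough: two adjacent vertices other than `c` would form a
  -- triangle with it.
  universal∧acyclic⇒≅star : ∀ {G : Graph (ℕ.suc n)} {c} → Universal G c → Acyclic G → G ≅ star (ℕ.suc n)
  universal∧acyclic⇒≅star {G} {c} universal acyclic = π , λ u v → mk⇔ (to u v) (from u v)
    where
    open Graph G

    π : Permutation′ (ℕ.suc n)
    π = transpose c zero

    πc≡0 : toℕ (π ⟨$⟩ʳ c) ≡ 0
    πc≡0 rewrite dec-true (c ≟ c) refl = refl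

    πu≡0⇒u≡c : ∀ u → toℕ (π ⟨$⟩ʳ u) ≡ 0 → u ≡ c
    πu≡0⇒u≡c u πu≡0 = Injection.injective (↔⇒↣ π) (toℕ-injective (trans πu≡0 (sym πc≡0)))

    centre~ : ∀ v → c ~ v → (π ⟨$⟩ʳ c) ⋆.~ (π ⟨$⟩ʳ v)
    centre~ v c~v = inj₁ (πc≡0 , λ πv≡0 → adjacent-≢ G c~v (sym (πu≡0⇒u≡c v πv≡0)))

    to : ∀ u v → u ~ v → (π ⟨$⟩ʳ u) ⋆.~ (π ⟨$⟩ʳ v)
    to u v u~v = by-cases (u ≟ c) (v ≟ c)
      where
      -- `π` itself computes by deciding `u ≟ c`. Passing the decisions as arguments keeps
      -- `π ⟨$⟩ʳ u` intact in the goal.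
      by-cases : Dec (u ≡ c) → Dec (v ≡ c) → (π ⟨$⟩ʳ u) ⋆.~ (π ⟨$⟩ʳ v)
      by-cases (yes refl) _          = centre~ v u~v
      by-cases (no _)     (yes refl) = swap (centre~ u (~-sym u~v))
      by-cases (no u≢c)   (no v≢c)   =
        ⊥-elim (acyclic 0 (triangle G (universal u u≢c) u~v (~-sym (universal v v≢c))))

    from-centre : ∀ u v → toℕ (π ⟨$⟩ʳ u) ≡ 0 → toℕ (π ⟨$⟩ʳ v) ≢ 0 → u ~ v
    from-centre u v πu≡0 πv≢0 = subst (_~ v) (sym (πu≡0⇒u≡c u πu≡0))
      (universal v λ v≡c → πv≢0 (trans (cong (λ x → toℕ (π ⟨$⟩ʳ x)) v≡c) πc≡0))

    from : ∀ u v → (π ⟨$⟩ʳ u) ⋆.~ (π ⟨$⟩ʳ v) → u ~ v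
    from u v (inj₁ (πu≡0 , πv≢0)) = from-centre u v πu≡0 πv≢0
    from u v (inj₂ (πv≡0 , πu≢0)) = ~-sym (from-centre v u πv≡0 πu≢0)

mainTheorem7 : (∀ {n : ℕ} (G : Graph n) (e : HasEdge G) →
    (+ 2 / 1 ≤ av₁ G e)
    × (av₁ G e ≡ + 2 / 1 ⇔ (∀ u v → Graph._~_ G u v → Graph.N G u ∪ Graph.N G v ≡ ⊤)))
    × (∀ (n : ℕ) (2≤n : 2 ℕ.≤ n) →
    IsMinimiser IsTree (tree-hasEdge 2≤n) (star n)
    × (∀ (T : Graph n) → IsMinimiser IsTree (tree-hasEdge 2≤n) T → T ≅ star n)
    × IsMinimiser HasEdge id (star n))
mainTheorem7 = (λ G e → 2≤av₁ G e , mk⇔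
    (λ eq u v u~v → Equivalence.from (N∪N≡⊤⇔Dominating G) (Equivalence.to (av₁≡2⇔dominating G e) eq u v u~v))
    (λ cover → Equivalence.from (av₁≡2⇔dominating G e) λ u v u~v →
      Equivalence.to (N∪N≡⊤⇔Dominating G) (cover u v u~v)))
  , minimisers
  where
  minimisers : ∀ (n : ℕ) (2≤n : 2 ℕ.≤ n) →
    IsMinimiser IsTree (tree-hasEdge 2≤n) (star n)
    × (∀ (T : Graph n) → IsMinimiser IsTree (tree-hasEdge 2≤n) T → T ≅ star n)
    × IsMinimiser HasEdge id (star n)
  minimisers (ℕ.suc (ℕ.suc m)) 2≤n@(s≤s (s≤s z≤n)) =
      (star-isTree , λ H t → star-minimal e⋆ H (tree-hasEdge 2≤n t))
    , unique
    , (e⋆ , star-minimal e⋆)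
    where
    ⋆ : Graph (2 ℕ.+ m)
    ⋆ = star (2 ℕ.+ m)

    e⋆ : HasEdge ⋆
    e⋆ = tree-hasEdge 2≤n star-isTree

    av₁-star : ∀ e → av₁ ⋆ e ≡ + 2 / 1
    av₁-star e = Equivalence.from (av₁≡2⇔dominating ⋆ e) star-dominating

    -- The bound 2 holds for every graph with an edge, so one comparison serves both the class of
    -- trees and the class of all such graphs.
    star-minimal : ∀ e (H : Graph (2 ℕ.+ m)) (e′ : HasEdge H) → av₁ ⋆ e ≤ av₁ H e′
    star-minimal e H e′ = subst (_≤ av₁ H e′) (sym (av₁-star e)) (2≤av₁ H e′)

    unique : ∀ (T : Graph (2 ℕ.+ m)) → IsMinimiser IsTree (tree-hasEdge 2≤n) T → T ≅ ⋆
    unique T (t , minimal) = universal∧acyclic⇒≅star (proj₂ centre) (IsTree.acyclic t)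
      where
      e = tree-hasEdge 2≤n t

      av₁≡2 : av₁ T e ≡ + 2 / 1
      -- The star is itself a competing tree, so a minimal `T` cannot exceed its value 2.
      av₁≡2 = ℚ.≤-antisym (subst (av₁ T e ≤_) (av₁-star e⋆) (minimal ⋆ star-isTree)) (2≤av₁ T e)

      centre : ∃ (Universal T)
      centre = dominating∧acyclic⇒universal T e (IsTree.acyclic t)
        (Equivalence.to (av₁≡2⇔dominating T e) av₁≡2)
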